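{- For all integers $n\geq 8$, $p_{\mathrm{od}}^{\mathrm{ed}}(n)< p_{\mathrm{eu}}^{\mathrm{od}}(n)$.
   Context: A partition of a non-negative integer $n$ is a non-increasing (finite, possibly empty) sequence of positive integers, called parts, summing to $n$. $p_{\mathrm{od}}^{\mathrm{ed}}(n)$ is the number of partitions of $n$ in which every even part is larger than every odd part, the even parts are pairwise distinct, and the odd parts are pairwise distinct. $p_{\mathrm{eu}}^{\mathrm{od}}(n)$ is the number of partitions of $n$ in which every odd part is larger than every even part, the odd parts are pairwise distinct, and the even parts are unrestricted (may be repeated). In both cases partitions with no even parts or with no odd parts are allowed. -}

module Defs where

open import Data.List.Base using (List; []; _∷_; [_]; concatMap; filter; length; map; upTo)
open import Data.List.Membership.Propositional using (_∈_; find; lose)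
open import Data.List.Membership.Propositional.Properties
  using (∈-map⁺; ∈-map⁻; ∈-concatMap⁺; ∈-concatMap⁻; ∈-upTo⁺; ∈-upTo⁻)
open import Data.List.Properties using (∷-injectiveˡ; ∷-injectiveʳ)
open import Data.List.Relation.Unary.All as All using (All; []; _∷_; all?)
import Data.List.Relation.Unary.All.Properties as All
open import Data.List.Relation.Unary.AllPairs as AllPairs using ([]; _∷_)
import Data.List.Relation.Unary.AllPairs.Properties as AllPairs
open import Data.List.Relation.Unary.Any using (here)
open import Data.List.Relation.Unary.Linked using (Linked; []; [-]; _∷_)
open import Data.List.Relation.Unary.Unique.Propositional using (Unique)
import Data.List.Relation.Unary.Unique.Propositional.Properties as Unique
open import Data.Nat.Base
open import Data.Nat.Divisibility using (_∣?_)
open import Data.Nat.ListAction using (sum)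
open import Data.Nat.Properties
open import Data.List.Relation.Unary.Unique.DecPropositional _≟_ using (unique?)
open import Data.Product.Base using (_×_; _,_)
open import Data.List.Relation.Binary.Disjoint.Propositional using (Disjoint)
open import Function.Base using (_∘_)
open import Function.Bundles using (_⇔_; mk⇔)
open import Relation.Binary.PropositionalEquality using (_≡_; _≢_; refl; sym; trans; cong; subst)
open import Relation.Nullary.Decidable using (Dec; _×-dec_; ¬?)
open import Relation.Unary using (Pred; Decidable)
open import Level using (0ℓ)

IsPartition : ℕ → List ℕ → Set
IsPartition n λs = Linked _≥_ λs × All (0 <_) λs × sum λs ≡ n

evens odds : List ℕ → List ℕ
evens = filter (2 ∣?_)
odds  = filter (¬? ∘ (2 ∣?_))

AllGreater : List ℕ → List ℕ → Set
AllGreater xs ys = All (λ x → All (_< x) ys) xs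

OdEd : List ℕ → Set
OdEd λs = AllGreater (evens λs) (odds λs) × Unique (evens λs) × Unique (odds λs)

EuOd : List ℕ → Set
EuOd λs = AllGreater (odds λs) (evens λs) × Unique (odds λs)

allGreater? : ∀ xs ys → Dec (AllGreater xs ys)
allGreater? xs ys = all? (λ x → all? (_<? x) ys) xs

odEd? : Decidable OdEd
odEd? λs = allGreater? (evens λs) (odds λs) ×-dec unique? (evens λs) ×-dec unique? (odds λs)

euOd? : Decidable EuOd
euOd? λs = allGreater? (odds λs) (evens λs) ×-dec unique? (odds λs)

-- The partitions of n into at most k parts, each at most m.  The largest
-- part of a partition of suc n is written suc i.
boundedPartitions : (k m n : ℕ) → List (List ℕ)
boundedPartitions _       _ zero    = [ [] ]
boundedPartitions zero    _ (suc n) = []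
boundedPartitions (suc k) m (suc n) =
  concatMap (λ i → map (suc i ∷_) (boundedPartitions k (suc i) (n ∸ i))) (upTo (m ⊓ suc n))

-- See ∈-partitions and partitions-unique below: every partition of n is
-- listed exactly once.
partitions : ℕ → List (List ℕ)
partitions n = boundedPartitions n n n

count : {P : Pred (List ℕ) 0ℓ} → Decidable P → ℕ → ℕ
count P? n = length (filter P? (partitions n))

-- The subscript (the smaller parts) comes first, then the superscript (the
-- larger parts): e/o for even/odd parts, d/u for distinct/unrestricted.
p-od-ed p-eu-od : ℕ → ℕ
p-od-ed = count odEd?
p-eu-od = count euOd?

private

  sound : ∀ k m n {xs} → xs ∈ boundedPartitions k m n →
          Linked _≥_ (m ∷ xs) × All (0 <_) xs × sum xs ≡ n
  sound _ m zero (here refl) = [-] , [] , refl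
  sound (suc k) m (suc n) xs∈
    with find (∈-concatMap⁻ (λ i → map (suc i ∷_) (boundedPartitions k (suc i) (n ∸ i)))
                           {xs = upTo (m ⊓ suc n)} xs∈)
  ... | i , i∈ , xs∈′ with ∈-map⁻ (suc i ∷_) xs∈′
  ... | ys , ys∈ , refl with sound k (suc i) (n ∸ i) ys∈
  ... | lk , pos , Σys =
    m≤n⊓o⇒m≤n m (suc n) (∈-upTo⁻ i∈) ∷ lk , s≤s z≤n ∷ pos ,
    cong suc (trans (cong (i +_) Σys) (m+[n∸m]≡n (≤-pred (m≤n⊓o⇒m≤o m (suc n) (∈-upTo⁻ i∈)))))

  complete : ∀ k m n {xs} → Linked _≥_ (m ∷ xs) → All (0 <_) xs → sum xs ≡ n →
             length xs ≤ k → xs ∈ boundedPartitions k m n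
  complete _ m zero {[]} _ _ _ _ = here refl
  complete (suc k) m (suc n) {suc i ∷ ys} (m≥ ∷ lk) (_ ∷ pos) Σxs (s≤s len) =
    ∈-concatMap⁺ (λ j → map (suc j ∷_) (boundedPartitions k (suc j) (n ∸ j)))
      (lose (∈-upTo⁺ (⊓-glb m≥ (s≤s i≤n)))
        (∈-map⁺ (suc i ∷_) (complete k (suc i) (n ∸ i) lk pos Σys len)))
    where
    i+Σ≡n : i + sum ys ≡ n
    i+Σ≡n = suc-injective Σxs
    i≤n : i ≤ n
    i≤n = subst (i ≤_) i+Σ≡n (m≤m+n i (sum ys))
    Σys : sum ys ≡ n ∸ i
    Σys = trans (sym (m+n∸m≡n i (sum ys))) (cong (_∸ i) i+Σ≡n)
  complete k m zero    {suc _ ∷ _} _ _ () _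
  complete k m zero    {zero ∷ _} _ (() ∷ _) _ _
  complete k m (suc n) {zero ∷ _} _ (() ∷ _) _ _

  length≤sum : ∀ {xs} → All (0 <_) xs → length xs ≤ sum xs
  length≤sum []        = z≤n
  length≤sum (p ∷ pos) = +-mono-≤ p (length≤sum pos)

  bound : ∀ {xs} → Linked _≥_ xs → Linked _≥_ (sum xs ∷ xs)
  bound []            = [-]
  bound {x ∷ xs} lk   = m≤m+n x (sum xs) ∷ lk

  unbound : ∀ {m xs} → Linked _≥_ (m ∷ xs) → Linked _≥_ xs
  unbound [-]      = []
  unbound (_ ∷ lk) = lk

  unique : ∀ k m n → Unique (boundedPartitions k m n)
  unique _       _ zero    = [] ∷ []
  unique zero    _ (suc n) = []
  unique (suc k) m (suc n) = Unique.concat⁺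
    (All.map⁺ (All.universal
      (λ i → Unique.map⁺ ∷-injectiveʳ (unique k (suc i) (n ∸ i))) (upTo (m ⊓ suc n))))
    (AllPairs.map⁺ (AllPairs.map disjoint (Unique.upTo⁺ (m ⊓ suc n))))
    where
    disjoint : ∀ {i j} → i ≢ j →
               Disjoint (map (suc i ∷_) (boundedPartitions k (suc i) (n ∸ i)))
                        (map (suc j ∷_) (boundedPartitions k (suc j) (n ∸ j)))
    disjoint {i} {j} i≢j (xs∈i , xs∈j)
      with ∈-map⁻ (suc i ∷_) xs∈i | ∈-map⁻ (suc j ∷_) xs∈j
    ... | _ , _ , refl | _ , _ , eq = i≢j (suc-injective (∷-injectiveˡ eq))

∈-partitions : ∀ {n λs} → λs ∈ partitions n ⇔ IsPartition n λs
∈-partitions {n} = mk⇔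
  (λ λs∈ → let lk , pos , Σ = sound n n n λs∈ in unbound lk , pos , Σ)
  (λ { (lk , pos , refl) → complete n n n (bound lk) pos refl (length≤sum pos) })

partitions-unique : ∀ n → Unique (partitions n)
partitions-unique n = unique n n n

{-# OPTIONS --safe #-}

-- A partition counted by p-eu-od with l odd parts amounts to a partition σ of
-- (n − l²)/2.  One counted by p-od-ed with k even and l odd parts amounts to a
-- partition τ into at most k + l parts whose sum is smaller than (n − l²)/2 by
-- kl + k(k−1)/2.  If l = 0, the p-od-ed partition is itself a p-eu-od partition.
-- For l ≥ 1, map (k, τ) to σ as follows.  If k = 0, take σ = τ.  If k ≥ 2, add 1
-- to each of the k + l parts and the remaining excess to the largest part, so
-- that the two largest parts of σ are far apart.  If k = 1, there is a deficit of
-- 1 instead, taken from the largest part; this fails when the two largest parts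
-- of τ agree, but then σ can be chosen with more parts, the two largest being
-- too close for it to come from k ≥ 2.  Only τ = 0 with k = 1 is left, for which
-- n + 1 = (l + 1)², so at most one partition of n is left.  It is sent to the σ
-- with parts 2, 1, …, 1 and l ∈ {0, 1}, and the σ with parts 1, …, 1 remains.

module Submission where

open import Defs
open import Data.Nat.Base using (ℕ; _≤_; _<_)

open import Data.List.Base
  using (List; []; _∷_; _++_; [_]; map; length; filter; replicate; take; drop)
open import Data.List.Membership.Propositional using (_∈_)
open import Data.List.Membership.Propositional.Properties
  using (∈-∃++; ∈-++⁺ˡ; ∈-++⁺ʳ; ∈-++⁻; ∈-filter⁺; ∈-filter⁻)
open import Data.List.Properties
  using (length-map; length-++; length-++-sucʳ; length-replicate; map-++; map-∘; map-id; map-injective;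
         filter-accept; filter-reject; filter-none; ∷-injectiveˡ; ∷-injectiveʳ; ++-assoc;
         drop-all)
open import Data.List.Relation.Unary.All as All using (All; []; _∷_)
import Data.List.Relation.Unary.All.Properties as All
open import Data.List.Relation.Unary.AllPairs using ([]; _∷_)
open import Data.List.Relation.Unary.Any using (here; there)
open import Data.List.Relation.Unary.Linked as Linked using (Linked; []; [-]; _∷_)
open import Data.List.Relation.Unary.Linked.Properties using (Linked⇒All)
open import Data.List.Relation.Unary.Unique.Propositional using (Unique)
import Data.List.Relation.Unary.Unique.Propositional.Properties as Unique
open import Data.Nat.Base
  using (zero; suc; pred; _+_; _*_; _∸_; _≥_; z≤n; s≤s; s≤s⁻¹; z<s; s<s)
open import Data.Nat.Divisibility using (_∣_; _∣?_; divides; m∣m*n; _∤_)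
open import Data.Nat.ListAction using (sum)
open import Data.Nat.ListAction.Properties using (sum-++)
open import Data.Nat.Properties
open import Data.Nat.Tactic.RingSolver using (solve-∀)
open import Data.Product.Base using (_×_; _,_; proj₂; ∃; ∃-syntax)
open import Data.Sum.Base using (_⊎_; inj₁; inj₂)
open import Function.Base using (_∘_)
open import Function.Bundles using (Equivalence)
open import Relation.Binary.PropositionalEquality
  using (_≡_; _≢_; refl; sym; trans; cong; cong₂; subst; module ≡-Reasoning)
open import Relation.Nullary using (¬_; yes; no; contradiction)
open import Relation.Nullary.Decidable using (¬?)
open import Relation.Binary.Definitions using (tri<; tri≈; tri>)

-- Comparing lengths of lists through an injective relation.

∈-remove : ∀ {A : Set} {x y : A} as {bs} → x ≢ y → x ∈ as ++ [ y ] ++ bs → x ∈ as ++ bs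
∈-remove as x≢y x∈ with ∈-++⁻ as x∈
... | inj₁ x∈as         = ∈-++⁺ˡ x∈as
... | inj₂ (here x≡y)   = contradiction x≡y x≢y
... | inj₂ (there x∈bs) = ∈-++⁺ʳ as x∈bs

module _ {A B : Set} (R : A → B → Set)
         (injective : ∀ {x x′ y} → R x y → R x′ y → x ≡ x′) where

  -- Induction on `xs`: the image of the head is deleted from `ys`, and injectivity keeps the images
  -- of the other elements away from it.
  injection⇒length≤ : ∀ {xs} ys → Unique xs →
    (∀ {x} → x ∈ xs → ∃[ y ] y ∈ ys × R x y) → length xs ≤ length ys
  injection⇒length≤ {[]}     ys _          _     = z≤n
  injection⇒length≤ {x ∷ xs} ys (x∉ ∷ uxs) image
    with y , y∈ , xRy ← image (here refl)
    with as , bs , refl ← ∈-∃++ y∈ =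
    subst (suc (length xs) ≤_) (sym (length-++-sucʳ as y bs))
      (s≤s (injection⇒length≤ (as ++ bs) uxs λ {x′} x′∈ →
        let y′ , y′∈ , x′Ry′ = image (there x′∈) in
        y′ , ∈-remove as (λ y′≡y → All.lookup x∉ x′∈ (injective xRy (subst (R x′) y′≡y x′Ry′))) y′∈ , x′Ry′))

  injection⇒length< : ∀ {xs ys y₀} → Unique xs →
    (∀ {x} → x ∈ xs → ∃[ y ] y ∈ ys × R x y) →
    y₀ ∈ ys → (∀ x → ¬ R x y₀) → length xs < length ys
  injection⇒length< {xs} {y₀ = y₀} uxs image y₀∈ ¬R
    with as , bs , refl ← ∈-∃++ y₀∈ =
    subst (suc (length xs) ≤_) (sym (length-++-sucʳ as y₀ bs))
      (s≤s (injection⇒length≤ (as ++ bs) uxs λ {x} x∈ →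
        let y , y∈ , xRy = image x∈ in
        y , ∈-remove as (λ y≡y₀ → ¬R x (subst (R x) y≡y₀ xRy)) y∈ , xRy))

-- Descending lists and parity.

Desc : List ℕ → Set
Desc = Linked _≥_

All≤head : ∀ {x xs} → Desc (x ∷ xs) → All (_≤ x) xs
All≤head [-]        = []
All≤head (x≥y ∷ lk) = Linked⇒All (λ p q → ≤-trans q p) x≥y lk

2∤1+2* : ∀ x → 2 ∤ suc (2 * x)
2∤1+2* x (divides q eq) = even≢odd q x (trans (*-comm 2 q) (sym eq))

2∣2* : ∀ x → 2 ∣ 2 * x
2∣2* x = m∣m*n x

half : ∀ n → ∃[ h ] (n ≡ 2 * h ⊎ n ≡ suc (2 * h))
half zero = 0 , inj₁ refl
half (suc n) with half n
... | h , inj₁ refl = h , inj₂ refl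
... | h , inj₂ refl = suc h , inj₁ (sym (*-suc 2 h))

evens-even : ∀ x xs → evens (2 * x ∷ xs) ≡ 2 * x ∷ evens xs
evens-even x xs = filter-accept (2 ∣?_) (2∣2* x)

evens-odd : ∀ x xs → evens (suc (2 * x) ∷ xs) ≡ evens xs
evens-odd x xs = filter-reject (2 ∣?_) (2∤1+2* x)

odds-even : ∀ x xs → odds (2 * x ∷ xs) ≡ odds xs
odds-even x xs = filter-reject (¬? ∘ (2 ∣?_)) (λ ¬p → ¬p (2∣2* x))

odds-odd : ∀ x xs → odds (suc (2 * x) ∷ xs) ≡ suc (2 * x) ∷ odds xs
odds-odd x xs = filter-accept (¬? ∘ (2 ∣?_)) (2∤1+2* x)

-- Encoding of the partitions with odd parts above even parts.

-- For l ≤ length σ, this encodes the partitions counted by p-eu-od that have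
-- exactly l odd parts; the parts exceed 2σ by the staircase 2l−1, …, 3, 1.
euod : ℕ → List ℕ → List ℕ
euod zero    σ       = map (2 *_) σ
euod (suc l) []      = []
euod (suc l) (x ∷ σ) = suc (2 * (x + l)) ∷ euod l σ

sum-map-2* : ∀ xs → sum (map (2 *_) xs) ≡ 2 * sum xs
sum-map-2* []       = refl
sum-map-2* (x ∷ xs) = trans (cong (2 * x +_) (sum-map-2* xs)) (sym (*-distribˡ-+ 2 x (sum xs)))

-- The staircase of the first `l` odd numbers adds up to `l * l`.
sum-euod : ∀ l σ → l ≤ length σ → sum (euod l σ) ≡ 2 * sum σ + l * l
sum-euod zero    σ       _        = trans (sum-map-2* σ) (sym (+-identityʳ _))
sum-euod (suc l) (x ∷ σ) (s≤s l≤) = begin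
  suc (2 * (x + l)) + sum (euod l σ)      ≡⟨ cong (suc (2 * (x + l)) +_) (sum-euod l σ l≤) ⟩
  suc (2 * (x + l)) + (2 * sum σ + l * l) ≡⟨ identity x l (sum σ) ⟩
  2 * (x + sum σ) + suc l * suc l         ∎
  where
  open ≡-Reasoning
  identity : ∀ x l s → suc (2 * (x + l)) + (2 * s + l * l) ≡ 2 * (x + s) + suc l * suc l
  identity = solve-∀

-- The parity of the first part tells whether `l` is zero; otherwise one part is peeled off. Without
-- the length bounds, every `euod (suc l) []` would be `[]`.
euod-injective : ∀ l l′ {σ σ′} → l ≤ length σ → l′ ≤ length σ′ →
                 euod l σ ≡ euod l′ σ′ → l ≡ l′ × σ ≡ σ′
euod-injective zero zero _ _ eq = refl , map-injective (λ {x} {y} → *-cancelˡ-≡ x y 2) eq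
euod-injective zero (suc l′) {x ∷ _} {x′ ∷ _} _ _ eq =
  contradiction (∷-injectiveˡ eq) (even≢odd x (x′ + l′))
euod-injective (suc l) zero {x ∷ _} {x′ ∷ _} _ _ eq =
  contradiction (sym (∷-injectiveˡ eq)) (even≢odd x′ (x + l))
euod-injective (suc l) (suc l′) {x ∷ σ} {x′ ∷ σ′} (s≤s l≤) (s≤s l′≤) eq
  with refl , refl ← euod-injective l l′ l≤ l′≤ (∷-injectiveʳ eq) =
  refl , cong (_∷ σ) (+-cancelʳ-≡ l x x′ (*-cancelˡ-≡ _ _ 2 (suc-injective (∷-injectiveˡ eq))))

-- The bound is the part that `euod (suc l)` puts in front for a new entry `y`. Order, distinctness
-- and separation of parities all follow from it.
euod-<-odd : ∀ l y σ → l ≤ length σ → All (_≤ y) σ → All (_< suc (2 * (y + l))) (euod l σ)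
euod-<-odd zero y σ _ σ≤ = All.map⁺ (All.map (λ x≤ → s≤s (*-monoʳ-≤ 2 (m≤n⇒m≤n+o 0 x≤))) σ≤)
euod-<-odd (suc l) y (x ∷ σ) (s≤s l≤) (x≤ ∷ σ≤) =
  s<s (*-monoʳ-< 2 (≤-trans (s≤s (+-monoˡ-≤ l x≤)) (≤-reflexive (sym (+-suc y l))))) ∷
  All.map (λ p → ≤-trans p (s≤s (*-monoʳ-≤ 2 (+-monoʳ-≤ y (n≤1+n l))))) (euod-<-odd l y σ l≤ σ≤)

∷-desc : ∀ {x xs} → All (_≤ x) xs → Desc xs → Desc (x ∷ xs)
∷-desc {xs = []}    _        _  = [-]
∷-desc {xs = _ ∷ _} (x≥ ∷ _) lk = x≥ ∷ lk

euod-desc : ∀ l {σ} → l ≤ length σ → Desc σ → Desc (euod l σ)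
euod-desc zero    {[]}        _        _          = []
euod-desc zero    {_ ∷ []}    _        _          = [-]
euod-desc zero    {_ ∷ _ ∷ _} _        (x≥y ∷ lk) = *-monoʳ-≤ 2 x≥y ∷ euod-desc zero z≤n lk
euod-desc (suc l) {x ∷ σ}     (s≤s l≤) lk         =
  ∷-desc (All.map <⇒≤ (euod-<-odd l x σ l≤ (All≤head lk))) (euod-desc l l≤ (Linked.tail lk))

-- The first `l` entries may be zero, since they become odd parts.
euod-positive : ∀ l {σ} → All (0 <_) (drop l σ) → All (0 <_) (euod l σ)
euod-positive zero    {σ}     pos = All.map⁺ (All.map (*-monoʳ-< 2) pos)
euod-positive (suc l) {[]}    pos = []
euod-positive (suc l) {x ∷ σ} pos = z<s ∷ euod-positive l pos

odds-map-2* : ∀ σ → odds (map (2 *_) σ) ≡ []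
odds-map-2* σ = filter-none (¬? ∘ (2 ∣?_)) (All.map⁺ (All.universal (λ x ¬p → ¬p (2∣2* x)) σ))

euod-EuOd : ∀ l {σ} → l ≤ length σ → Desc σ → EuOd (euod l σ)
euod-EuOd zero {σ} _ _ rewrite odds-map-2* σ = [] , []
euod-EuOd (suc l) {x ∷ σ} (s≤s l≤) lk
  rewrite odds-odd (x + l) (euod l σ) | evens-odd (x + l) (euod l σ)
  with eu , od ← euod-EuOd l l≤ (Linked.tail lk)
  with below ← euod-<-odd l x σ l≤ (All≤head lk) =
  All.filter⁺ (2 ∣?_) below ∷ eu ,
  All.map (λ y<x x≡y → <⇒≢ y<x (sym x≡y)) (All.filter⁺ (¬? ∘ (2 ∣?_)) below) ∷ od

-- Encoding of the partitions with even parts above odd parts.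

-- For k ≤ length τ, this encodes the partitions counted by p-od-ed that have
-- exactly k even parts: adding 1 to these makes all parts odd and distinct.
oded : ℕ → List ℕ → List ℕ
oded zero    τ       = euod (length τ) τ
oded (suc k) []      = []
oded (suc k) (x ∷ τ) = 2 * (x + length τ) ∷ oded k τ

-- Adding 1 to each of the `k` even parts leaves twice `τ` plus a full staircase of odd numbers.
sum-oded : ∀ k τ → k ≤ length τ → sum (oded k τ) + k ≡ 2 * sum τ + length τ * length τ
sum-oded zero    τ       _        = trans (+-identityʳ _) (sum-euod (length τ) τ ≤-refl)
sum-oded (suc k) (x ∷ τ) (s≤s k≤) = begin
  2 * (x + l) + sum (oded k τ) + suc k     ≡⟨ shuffle (2 * (x + l)) (sum (oded k τ)) k ⟩
  suc (2 * (x + l)) + (sum (oded k τ) + k) ≡⟨ cong (suc (2 * (x + l)) +_) (sum-oded k τ k≤) ⟩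
  suc (2 * (x + l)) + (2 * sum τ + l * l)  ≡⟨ identity x l (sum τ) ⟩
  2 * (x + sum τ) + suc l * suc l          ∎
  where
  open ≡-Reasoning
  l = length τ
  shuffle : ∀ a b k → a + b + suc k ≡ suc a + (b + k)
  shuffle = solve-∀
  identity : ∀ x l s → suc (2 * (x + l)) + (2 * s + l * l) ≡ 2 * (x + s) + suc l * suc l
  identity = solve-∀

-- Decodes one more leading part, `2 * y` or `suc (2 * y)`; the gap `room` makes the new entry at
-- least the head of `τ`.
extend : ∀ y τ → Desc τ → (∀ {t τ′} → τ ≡ t ∷ τ′ → t + length τ′ < y) →
         ∃[ z ] z + length τ ≡ y × Desc (z ∷ τ)
extend y []       _  _    = y , +-identityʳ y , [-]
extend y (t ∷ τ) lk room =
  y ∸ suc (length τ) , m∸n+n≡m (≤-trans (m≤n+m _ t) t+l<y) ,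
  m+n≤o⇒m≤o∸n t t+l<y ∷ lk
  where
  t+l<y : t + suc (length τ) ≤ y
  t+l<y = ≤-trans (≤-reflexive (+-suc t (length τ))) (room refl)

-- The part after `2 * y` is strictly smaller: if odd, because even parts exceed odd ones; if even,
-- because even parts are distinct.
room-even : ∀ {y τ} k → k ≤ length τ → Desc (2 * y ∷ oded k τ) →
            All (_< 2 * y) (odds (oded k τ)) → All (2 * y ≢_) (evens (oded k τ)) →
            ∀ {t τ′} → τ ≡ t ∷ τ′ → t + length τ′ < y
room-even {y} zero    _ _ x> _ {t} {τ′} refl
  rewrite odds-odd (t + length τ′) (euod (length τ′) τ′) =
  *-cancelˡ-< 2 _ y (<-trans (n<1+n _) (All.head x>))
room-even {y} (suc k) _ (x≥ ∷ _) _ x≢ {t} {τ′} refl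
  rewrite evens-even (t + length τ′) (oded k τ′) =
  *-cancelˡ-< 2 _ y (≤∧≢⇒< x≥ (λ eq → All.head x≢ (sym eq)))

room-odd : ∀ {y} τ → Desc (suc (2 * y) ∷ oded 0 τ) → All (suc (2 * y) ≢_) (odds (oded 0 τ)) →
           ∀ {t τ′} → τ ≡ t ∷ τ′ → t + length τ′ < y
room-odd {y} (t ∷ τ) (x≥ ∷ _) x≢ refl
  rewrite odds-odd (t + length τ) (euod (length τ) τ) =
  *-cancelˡ-< 2 _ y (s≤s⁻¹ (≤∧≢⇒< x≥ (λ eq → All.head x≢ (sym eq))))

oded-surjective : ∀ {λs} → Desc λs → OdEd λs →
                  ∃[ k ] ∃[ τ ] k ≤ length τ × Desc τ × oded k τ ≡ λs
oded-surjective {[]}    _  _ = 0 , [] , z≤n , [] , refl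
oded-surjective {x ∷ xs} lk oe with half x
... | y , inj₁ refl
  rewrite evens-even y xs | odds-even y xs
  with (x> ∷ gr) , (x≢ ∷ ue) , uo ← oe
  with oded-surjective (Linked.tail lk) (gr , ue , uo)
... | k , τ , k≤ , lkτ , refl
  with z , refl , lkz ← extend y τ lkτ (room-even k k≤ lk x> x≢) =
  suc k , z ∷ τ , s≤s k≤ , lkz , refl
oded-surjective {x ∷ xs} lk oe | y , inj₂ refl
  rewrite evens-odd y xs | odds-odd y xs
  with gr , ue , (x≢ ∷ uo) ← oe
  with oded-surjective (Linked.tail lk) (All.map All.tail gr , ue , uo)
-- An even part after an odd one would have to exceed it, against the descending order.
... | suc k , t ∷ τ , k≤ , lkτ , refl
  rewrite evens-even (t + length τ) (oded k τ) =
  contradiction (Linked.head lk) (<⇒≱ (All.head (All.head gr)))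
... | zero , τ , _ , lkτ , refl
  with z , refl , lkz ← extend y τ lkτ (room-odd τ lk x≢) =
  zero , z ∷ τ , z≤n , lkz , refl

-- The map from (k, τ) to σ and its inverse.

-- kl + k(k−1)/2 − k − l, for k = 2 + i even and l = suc m odd parts.
bonus : ℕ → ℕ → ℕ
bonus m zero    = m
bonus m (suc i) = bonus m i + (m + (2 + i))

-- Closed form, doubled to clear the denominator of k(k-1)/2.
2*bonus : ∀ m i → 2 * bonus m i ≡ 2 * (suc i * m) + (i * i + 3 * i)
2*bonus m zero    = trans (cong (2 *_) (sym (+-identityʳ m))) (sym (+-identityʳ _))
2*bonus m (suc i) = begin
  2 * (bonus m i + (m + (2 + i)))                               ≡⟨ *-distribˡ-+ 2 (bonus m i) _ ⟩
  2 * bonus m i + 2 * (m + (2 + i))                             ≡⟨ cong (_+ 2 * (m + (2 + i))) (2*bonus m i) ⟩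
  2 * (suc i * m) + (i * i + 3 * i) + 2 * (m + (2 + i))         ≡⟨ identity m i ⟩
  2 * (suc (suc i) * m) + (suc i * suc i + 3 * suc i)           ∎
  where
  open ≡-Reasoning
  identity : ∀ m i → 2 * (suc i * m) + (i * i + 3 * i) + 2 * (m + (2 + i))
                   ≡ 2 * (suc (suc i) * m) + (suc i * suc i + 3 * suc i)
  identity = solve-∀

m≤bonus : ∀ m i → m ≤ bonus m i
m≤bonus m zero    = ≤-refl
m≤bonus m (suc i) = ≤-trans (m≤bonus m i) (m≤m+n _ _)

i≤bonus : ∀ m i → i ≤ bonus m i
i≤bonus m zero    = z≤n
i≤bonus m (suc i) = ≤-trans (n≤1+n (suc i)) (≤-trans (m≤n+m (2 + i) m) (m≤n+m _ (bonus m i)))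

-- With l = suc m odd parts.  In flat, the conjugate of τ loses its smallest part
-- 2 + j and gains j ones and the part l + 2.
data Shape (m : ℕ) : ℕ → List ℕ → List ℕ → Set where
  none   : ∀ {τ} → length τ ≡ suc m → Shape m 0 τ τ
  strict : ∀ {x y τ} → y < x → length τ ≡ m →
           Shape m 1 (x ∷ y ∷ τ) (x ∷ suc y ∷ map suc τ)
  flat   : ∀ j t r ρ → r < t → suc (j + length ρ) ≡ m →
           Shape m 1 (t ∷ t ∷ replicate j t ++ r ∷ ρ)
                     (t + j ∷ t ∷ replicate j t ++ map suc (r ∷ ρ) ++ [ 1 ])
  const  : ∀ n t → suc n ≡ m →
           Shape m 1 (replicate (2 + m) (suc t)) (replicate (2 + m) (suc t) ++ replicate (suc m) 1)
  const₁ : ∀ t → m ≡ 0 →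
           Shape m 1 (replicate (2 + m) (2 + t)) (2 + t ∷ 1 + t ∷ 1 ∷ 1 ∷ [])
  many   : ∀ i {x y τ} → i + suc m ≡ length τ →
           Shape m (2 + i) (x ∷ y ∷ τ) (suc (x + bonus m i) ∷ suc y ∷ map suc τ)

-- The shapes of σ are told apart by its length and the difference of its two
-- largest parts.
undo : ℕ → ℕ → List ℕ → ℕ × List ℕ
undo m 0             σ           = 0 , σ
undo m 1             (x ∷ σ)     = 1 , x ∷ map pred σ
undo m (suc (suc i)) (a ∷ c ∷ σ) with bonus m i ≤? a ∸ c
undo m (suc (suc i))       (a ∷ c ∷ σ) | yes _ = 2 + i , a ∸ suc (bonus m i) ∷ pred c ∷ map pred σ
undo m (suc (suc zero))    (a ∷ c ∷ σ) | no  _ =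
  1 , take (2 + m) (c ∷ c ∷ replicate (a ∸ c) c ++ map pred (drop (a ∸ c) σ))
undo m (suc (suc (suc i))) (a ∷ c ∷ σ) | no  _ = 1 , replicate (2 + m) a
undo m _             σ           = 0 , σ

map-pred-suc : ∀ xs → map pred (map suc xs) ≡ xs
map-pred-suc xs = trans (sym (map-∘ xs)) (map-id xs)

take-++ : ∀ n (xs : List ℕ) {ys} → n ≡ length xs → take n (xs ++ ys) ≡ xs
take-++ n []       refl = refl
take-++ n (x ∷ xs) refl = cong (x ∷_) (take-++ _ xs refl)

drop-++ : ∀ n (xs : List ℕ) {ys} → n ≡ length xs → drop n (xs ++ ys) ≡ ys
drop-++ n []       refl = refl
drop-++ n (x ∷ xs) refl = drop-++ _ xs refl

length-flat : ∀ j t r ρ →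
  length (replicate j t ++ map suc (r ∷ ρ) ++ [ 1 ]) ≡ 2 + (j + length ρ)
length-flat j t r ρ = begin
  length (replicate j t ++ map suc (r ∷ ρ) ++ [ 1 ])
    ≡⟨ length-++ (replicate j t) ⟩
  length (replicate j t) + length (map suc (r ∷ ρ) ++ [ 1 ])
    ≡⟨ cong₂ _+_ (length-replicate j) (length-++ (map suc (r ∷ ρ))) ⟩
  j + (suc (length (map suc ρ)) + 1)
    ≡⟨ cong (λ l → j + (suc l + 1)) (length-map suc ρ) ⟩
  j + (suc (length ρ) + 1)
    ≡⟨ identity j (length ρ) ⟩
  2 + (j + length ρ) ∎
  where
  open ≡-Reasoning
  identity : ∀ j l → j + (suc l + 1) ≡ 2 + (j + l)
  identity = solve-∀

-- The excess `d` of the length is 0 for `none`, 1 for `strict`, 2 + i for `many i`, 2 for `flat`, 2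
-- + m for `const` and 3 for `const₁`. Where these meet, the two largest parts differ by at least
-- `bonus m i` for `many i` and by less for the others.
undo-shape : ∀ {m k τ σ} d → d + suc m ≡ length σ → Desc τ → Shape m k τ σ → undo m d σ ≡ (k , τ)
undo-shape {m} d eq lk (none eq′) with refl ← +-cancelʳ-≡ (suc m) d 0 (trans eq eq′) = refl
undo-shape {m} d eq lk (strict {x} {y} {τ} _ refl)
  with refl ← +-cancelʳ-≡ (suc m) d 1 (trans eq (cong (2 +_) (length-map suc τ))) =
  cong (λ ρ → 1 , x ∷ y ∷ ρ) (map-pred-suc τ)
undo-shape {m} d eq (x≥y ∷ lk) (many i {x} {y} {τ} eq′)
  with refl ← +-cancelʳ-≡ (suc m) d (2 + i) (trans eq (cong (2 +_) (trans (length-map suc τ) (sym eq′))))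
  with bonus m i ≤? x + bonus m i ∸ y
... | yes _ = cong₂ (λ z ρ → 2 + i , z ∷ y ∷ ρ) (m+n∸n≡m x (bonus m i)) (map-pred-suc τ)
... | no ≰  = contradiction (m+n≤o⇒m≤o∸n (bonus m i)
    (≤-trans (≤-reflexive (+-comm (bonus m i) y)) (+-monoˡ-≤ (bonus m i) x≥y))) ≰
undo-shape {m} d eq lk (const n t refl)
  with refl ← +-cancelʳ-≡ (suc m) d (2 + m) (trans eq
    (trans (length-++ (replicate (2 + m) (suc t)))
      (cong₂ _+_ (length-replicate (2 + m)) (length-replicate (suc m)))))
  with bonus m m ≤? t ∸ t
-- The difference is 0, whereas `bonus m m` is positive because `m` is.
... | yes p with () ← ≤-trans (≤-trans (s≤s z≤n) (m≤bonus m m)) (subst (bonus m m ≤_) (n∸n≡0 t) p)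
... | no _ = refl
-- For m = 0 the recipe of `const` would collide with `many 0`, as `bonus 0 0` is 0. Here the
-- difference 1 is compared with `bonus 0 1`, which is 2.
undo-shape {m} d eq lk (const₁ t refl)
  with refl ← +-cancelʳ-≡ 1 d 3 eq
  with 2 ≤? suc t ∸ t
... | yes p with s≤s () ← subst (2 ≤_) (m+n∸n≡m 1 t) p
... | no _ = refl
undo-shape {m} d eq lk (flat j t r ρ r<t refl)
  with refl ← +-cancelʳ-≡ (suc m) d 2 (trans eq (cong (2 +_) (length-flat j t r ρ)))
  -- `bonus m 0` is `m`, and the difference `j` is smaller.
  with m ≤? t + j ∸ t
... | yes p = contradiction (subst (m ≤_) (m+n∸m≡n t j) p) (<⇒≱ (s≤s (m≤m+n j (length ρ))))
-- The difference recovers `j` and hence the plateau; the appended 1 turns into a 0, which `take`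
-- cuts off.
... | no _  = cong (1 ,_) (begin
  take (2 + m) (t ∷ t ∷ replicate (t + j ∸ t) t
                ++ map pred (drop (t + j ∸ t) (ts ++ map suc (r ∷ ρ) ++ [ 1 ])))
    ≡⟨ cong (λ d → take (2 + m) (t ∷ t ∷ replicate d t ++ map pred (drop d (ts ++ map suc (r ∷ ρ) ++ [ 1 ]))))
            (m+n∸m≡n t j) ⟩
  take (2 + m) (t ∷ t ∷ ts ++ map pred (drop j (ts ++ map suc (r ∷ ρ) ++ [ 1 ])))
    ≡⟨ cong (λ xs → take (2 + m) (t ∷ t ∷ ts ++ map pred xs))
            (drop-++ j ts (sym (length-replicate j))) ⟩
  take (2 + m) (t ∷ t ∷ ts ++ map pred (map suc (r ∷ ρ) ++ [ 1 ]))
    ≡⟨ cong (λ xs → take (2 + m) (t ∷ t ∷ ts ++ xs)) (map-++ pred (map suc (r ∷ ρ)) [ 1 ]) ⟩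
  take (2 + m) (t ∷ t ∷ ts ++ map pred (map suc (r ∷ ρ)) ++ [ 0 ])
    ≡⟨ cong (λ xs → take (2 + m) (t ∷ t ∷ ts ++ xs ++ [ 0 ])) (map-pred-suc (r ∷ ρ)) ⟩
  take (2 + m) (t ∷ t ∷ ts ++ (r ∷ ρ) ++ [ 0 ])
    ≡⟨ cong (λ xs → take (2 + m) (t ∷ t ∷ xs)) (++-assoc ts (r ∷ ρ) [ 0 ]) ⟨
  take (2 + m) (t ∷ t ∷ (ts ++ r ∷ ρ) ++ [ 0 ])
    ≡⟨ take-++ (2 + m) (t ∷ t ∷ ts ++ r ∷ ρ) (cong (2 +_) (sym (trans (length-++ ts)
         (trans (cong (_+ suc (length ρ)) (length-replicate j)) (+-suc j (length ρ)))))) ⟩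
  t ∷ t ∷ ts ++ r ∷ ρ ∎)
  where
  open ≡-Reasoning
  ts = replicate j t

-- Length, positivity, order and sum of the shapes.

shape-length-τ : ∀ {m k τ σ} → Shape m k τ σ → length τ ≡ k + suc m
shape-length-τ (none eq)             = eq
shape-length-τ (strict _ eq)         = cong (2 +_) eq
shape-length-τ (flat j t r ρ _ refl) = cong (2 +_) (trans (length-++ (replicate j t))
  (trans (cong (_+ suc (length ρ)) (length-replicate j)) (+-suc j (length ρ))))
shape-length-τ {m} (const _ _ _)     = length-replicate (2 + m)
shape-length-τ {m} (const₁ _ _)      = length-replicate (2 + m)
shape-length-τ (many i eq)           = cong (2 +_) (sym eq)

shape-length-σ : ∀ {m k τ σ} → Shape m k τ σ → suc m ≤ length σ
shape-length-σ (none eq)             = ≤-reflexive (sym eq)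
shape-length-σ (strict {τ = τ} _ eq) =
  s≤s (m≤n⇒m≤1+n (≤-reflexive (sym (trans (length-map suc τ) eq))))
shape-length-σ (flat j t r ρ _ refl) = s≤s (m≤n⇒m≤1+n
  (≤-trans (n≤1+n _) (≤-reflexive (sym (length-flat j t r ρ)))))
shape-length-σ {m} (const _ t _) = ≤-trans (n≤1+n _) (≤-trans (m≤m+n (2 + m) (suc m))
  (≤-reflexive (sym (trans (length-++ (replicate (2 + m) (suc t)))
    (cong₂ _+_ (length-replicate (2 + m)) (length-replicate (suc m)))))))
shape-length-σ (const₁ _ refl)     = s≤s z≤n
shape-length-σ {m} (many i {τ = τ} eq) = m≤n⇒m≤1+n (m≤n⇒m≤1+n (≤-trans (m≤n+m (suc m) i)
  (≤-reflexive (trans eq (sym (length-map suc τ))))))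

map-suc-positive : ∀ xs → All (0 <_) (map suc xs)
map-suc-positive xs = All.map⁺ (All.universal (λ _ → z<s) xs)

shape-positive⁺ : ∀ {m k τ σ} → Shape m (suc k) τ σ → All (0 <_) σ
shape-positive⁺ (strict {τ = τ} y<x _)  = ≤-<-trans z≤n y<x ∷ z<s ∷ map-suc-positive τ
shape-positive⁺ (flat j t r ρ r<t _)    =
  ≤-trans 0<t (m≤m+n t j) ∷ 0<t ∷
  All.++⁺ (All.replicate⁺ j 0<t) (All.++⁺ (map-suc-positive (r ∷ ρ)) (z<s ∷ []))
  where
  0<t = ≤-<-trans z≤n r<t
shape-positive⁺ {m} (const _ _ _)       =
  All.++⁺ (All.replicate⁺ (2 + m) z<s) (All.replicate⁺ (suc m) z<s)
shape-positive⁺ (const₁ _ _)            = z<s ∷ z<s ∷ z<s ∷ z<s ∷ []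
shape-positive⁺ (many _ {τ = τ} _)      = z<s ∷ z<s ∷ map-suc-positive τ

-- In `none` zeros may occur, but all entries become odd parts and nothing is left after `drop`.
shape-positive : ∀ {m k τ σ} → Shape m k τ σ → All (0 <_) (drop (suc m) σ)
shape-positive {m} {zero} {τ} (none eq) =
  subst (All (0 <_)) (sym (drop-all (suc m) τ (≤-reflexive eq))) []
shape-positive {m} {suc _} s = All.drop⁺ (suc m) (shape-positive⁺ s)

map-suc-desc : ∀ {xs} → Desc xs → Desc (map suc xs)
map-suc-desc []         = []
map-suc-desc [-]        = [-]
map-suc-desc (x≥ ∷ lk)  = s≤s x≥ ∷ map-suc-desc lk

∷ʳ1-desc : ∀ {xs} → Desc xs → Desc (map suc xs ++ [ 1 ])
∷ʳ1-desc []        = [-]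
∷ʳ1-desc [-]       = s≤s z≤n ∷ [-]
∷ʳ1-desc (x≥ ∷ lk) = s≤s x≥ ∷ ∷ʳ1-desc lk

replicate-++-desc : ∀ n {x xs} → All (_≤ x) xs → Desc xs → Desc (replicate n x ++ xs)
replicate-++-desc zero    xs≤ lk = lk
replicate-++-desc (suc n) xs≤ lk =
  ∷-desc (All.++⁺ (All.replicate⁺ n ≤-refl) xs≤) (replicate-++-desc n xs≤ lk)

replicate-desc : ∀ n {x} → Desc (replicate n x)
replicate-desc zero    = []
replicate-desc (suc n) = ∷-desc (All.replicate⁺ n ≤-refl) (replicate-desc n)

++-desc⁻ʳ : ∀ xs {ys} → Desc (xs ++ ys) → Desc ys
++-desc⁻ʳ []       lk = lk
++-desc⁻ʳ (x ∷ xs) lk = ++-desc⁻ʳ xs (Linked.tail lk)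

shape-desc : ∀ {m k τ σ} → Shape m k τ σ → Desc τ → Desc σ
shape-desc (none _) lk = lk
shape-desc (strict y<x _) (_ ∷ lk) = y<x ∷ map-suc-desc lk
shape-desc (flat j t r ρ r<t _) lk =
  m≤m+n t j ∷ replicate-++-desc (suc j) (All.++⁺ (All.map⁺ (r<t ∷ All.map (λ x≤r → ≤-<-trans x≤r r<t)
    (All≤head lkρ))) (≤-<-trans z≤n r<t ∷ [])) (∷ʳ1-desc lkρ)
  where
  lkρ = ++-desc⁻ʳ (t ∷ t ∷ replicate j t) lk
shape-desc {m} (const _ t _) _ =
  replicate-++-desc (2 + m) (All.replicate⁺ (suc m) (s≤s z≤n)) (replicate-desc (suc m))
shape-desc (const₁ t _) _ = n≤1+n _ ∷ s≤s z≤n ∷ ≤-refl ∷ [-]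
shape-desc {m} (many i {x} _) (x≥y ∷ lk) = s≤s (≤-trans x≥y (m≤m+n x (bonus m i))) ∷ map-suc-desc lk

sum-map-suc : ∀ xs → sum (map suc xs) ≡ length xs + sum xs
sum-map-suc []       = refl
sum-map-suc (x ∷ xs) = cong suc (begin
  x + sum (map suc xs)      ≡⟨ cong (x +_) (sum-map-suc xs) ⟩
  x + (length xs + sum xs)  ≡⟨ x∙yz≈y∙xz x (length xs) (sum xs) ⟩
  length xs + (x + sum xs)  ∎)
  where
  open ≡-Reasoning
  x∙yz≈y∙xz : ∀ x y z → x + (y + z) ≡ y + (x + z)
  x∙yz≈y∙xz = solve-∀

sum-replicate : ∀ n x → sum (replicate n x) ≡ n * x
sum-replicate zero    x = refl
sum-replicate (suc n) x = cong (x +_) (sum-replicate n x)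

-- Matches `sum-euod` with `sum-oded`. For k = 1 it says that σ exceeds τ by `suc m`: one for each
-- of the 2 + m parts, less the deficit 1.
shape-sum : ∀ {m k τ σ} → Shape m k τ σ →
            2 * sum σ + suc m * suc m + k ≡ 2 * sum τ + (k + suc m) * (k + suc m)
shape-sum {m} {τ = τ} (none _) = +-identityʳ _
shape-sum {m} (strict {x} {y} {τ} _ refl) = begin
  2 * (x + suc (y + sum (map suc τ))) + suc m * suc m + 1
    ≡⟨ cong (λ s → 2 * (x + suc (y + s)) + suc m * suc m + 1) (sum-map-suc τ) ⟩
  2 * (x + suc (y + (m + sum τ))) + suc m * suc m + 1
    ≡⟨ identity x y m (sum τ) ⟩
  2 * (x + (y + sum τ)) + (2 + m) * (2 + m) ∎
  where
  open ≡-Reasoning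
  identity : ∀ x y m s → 2 * (x + suc (y + (m + s))) + suc m * suc m + 1
                       ≡ 2 * (x + (y + s)) + (2 + m) * (2 + m)
  identity = solve-∀
shape-sum (flat j t r ρ _ refl) = begin
  2 * (t + j + (t + sum (replicate j t ++ map suc (r ∷ ρ) ++ [ 1 ]))) + m * m + 1
    ≡⟨ cong (λ s → 2 * (t + j + (t + s)) + m * m + 1) (begin
      sum (replicate j t ++ map suc (r ∷ ρ) ++ [ 1 ])
        ≡⟨ sum-++ (replicate j t) _ ⟩
      u + sum (map suc (r ∷ ρ) ++ [ 1 ])
        ≡⟨ cong (u +_) (sum-++ (map suc (r ∷ ρ)) [ 1 ]) ⟩
      u + (sum (map suc (r ∷ ρ)) + 1)
        ≡⟨ cong (λ s → u + (s + 1)) (sum-map-suc (r ∷ ρ)) ⟩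
      u + (suc (length ρ) + (r + sum ρ) + 1) ∎) ⟩
  2 * (t + j + (t + (u + (suc (length ρ) + (r + sum ρ) + 1)))) + m * m + 1
    ≡⟨ identity t j u (length ρ) (r + sum ρ) ⟩
  2 * (t + (t + (u + (r + sum ρ)))) + suc m * suc m
    ≡⟨ cong (λ s → 2 * (t + (t + s)) + suc m * suc m) (sum-++ (replicate j t) (r ∷ ρ)) ⟨
  2 * (t + (t + sum (replicate j t ++ r ∷ ρ))) + suc m * suc m ∎
  where
  open ≡-Reasoning
  m = 2 + (j + length ρ)
  u = sum (replicate j t)
  identity : ∀ t j u l s →
    2 * (t + j + (t + (u + (suc l + s + 1)))) + (2 + (j + l)) * (2 + (j + l)) + 1
    ≡ 2 * (t + (t + (u + s))) + (3 + (j + l)) * (3 + (j + l))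
  identity = solve-∀
shape-sum {m} (const _ t _) = begin
  2 * sum (τ ++ replicate (suc m) 1) + suc m * suc m + 1
    ≡⟨ cong (λ s → 2 * s + suc m * suc m + 1)
            (trans (sum-++ τ _) (cong (sum τ +_) (sum-replicate (suc m) 1))) ⟩
  2 * (sum τ + suc m * 1) + suc m * suc m + 1
    ≡⟨ identity (sum τ) m ⟩
  2 * sum τ + (2 + m) * (2 + m) ∎
  where
  open ≡-Reasoning
  τ = replicate (2 + m) (suc t)
  identity : ∀ s m → 2 * (s + suc m * 1) + suc m * suc m + 1 ≡ 2 * s + (2 + m) * (2 + m)
  identity = solve-∀
shape-sum (const₁ t refl) = identity t
  where
  identity : ∀ t → 2 * (2 + t + (1 + t + (1 + (1 + 0)))) + 1 + 1 ≡ 2 * (2 + t + (2 + t + 0)) + 4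
  identity = solve-∀
shape-sum {m} (many i {x} {y} {τ} eq) = begin
  2 * (suc (x + b) + (suc y + sum (map suc τ))) + suc m * suc m + (2 + i)
    ≡⟨ cong (λ s → 2 * (suc (x + b) + (suc y + s)) + suc m * suc m + (2 + i))
            (trans (sum-map-suc τ) (cong (_+ sum τ) (sym eq))) ⟩
  2 * (suc (x + b) + (suc y + (i + suc m + sum τ))) + suc m * suc m + (2 + i)
    ≡⟨ isolate x y (sum τ) b m i ⟩
  2 * b + (2 * (suc x + (suc y + (i + suc m + sum τ))) + suc m * suc m + (2 + i))
    ≡⟨ cong (_+ (2 * (suc x + (suc y + (i + suc m + sum τ))) + suc m * suc m + (2 + i))) (2*bonus m i) ⟩
  2 * (suc i * m) + (i * i + 3 * i)
    + (2 * (suc x + (suc y + (i + suc m + sum τ))) + suc m * suc m + (2 + i))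
    ≡⟨ identity x y (sum τ) m i ⟩
  2 * (x + (y + sum τ)) + (2 + i + suc m) * (2 + i + suc m) ∎
  where
  open ≡-Reasoning
  b = bonus m i
  isolate : ∀ x y s b m i →
    2 * (suc (x + b) + (suc y + (i + suc m + s))) + suc m * suc m + (2 + i)
    ≡ 2 * b + (2 * (suc x + (suc y + (i + suc m + s))) + suc m * suc m + (2 + i))
  isolate = solve-∀
  identity : ∀ x y s m i → 2 * (suc i * m) + (i * i + 3 * i)
      + (2 * (suc x + (suc y + (i + suc m + s))) + suc m * suc m + (2 + i))
    ≡ 2 * (x + (y + s)) + (2 + i + suc m) * (2 + i + suc m)
  identity = solve-∀

sum-euod-shape : ∀ {m k τ σ} → Shape m k τ σ → sum (euod (suc m) σ) ≡ sum (oded k τ)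
sum-euod-shape {m} {k} {τ} {σ} s = +-cancelʳ-≡ k _ _ (begin
  sum (euod (suc m) σ) + k               ≡⟨ cong (_+ k) (sum-euod (suc m) σ (shape-length-σ s)) ⟩
  2 * sum σ + suc m * suc m + k          ≡⟨ shape-sum s ⟩
  2 * sum τ + (k + suc m) * (k + suc m)  ≡⟨ cong (λ l → 2 * sum τ + l * l) eq ⟨
  2 * sum τ + length τ * length τ        ≡⟨ sum-oded k τ (≤-trans (m≤m+n k (suc m)) (≤-reflexive (sym eq))) ⟨
  sum (oded k τ) + k                     ∎)
  where
  open ≡-Reasoning
  eq = shape-length-τ s

-- Existence of a shape for every pair.

-- A first drop leads to `flat`; a constant list leads to `const`, `const₁` or an exception.
plateau : ∀ t τ → Desc (t ∷ τ) →
          τ ≡ replicate (length τ) t ⊎ ∃[ j ] ∃[ r ] ∃[ ρ ] τ ≡ replicate j t ++ r ∷ ρ × r < t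
plateau t [] _ = inj₁ refl
plateau t (y ∷ τ) (t≥y ∷ lk) with m≤n⇒m<n∨m≡n t≥y
... | inj₁ y<t  = inj₂ (0 , y , τ , refl , y<t)
... | inj₂ refl with plateau t τ lk
... | inj₁ eq                    = inj₁ (cong (t ∷_) eq)
... | inj₂ (j , r , ρ , eq , r<) = inj₂ (suc j , r , ρ , cong (t ∷_) eq , r<)

-- The two exceptions are the partition of 7 into 4 and 3, and the partition
-- 2l, 2l−1, 2l−3, …, 1, where l = suc m.
shape-total : ∀ {m} k {τ} → length τ ≡ k + suc m → Desc τ → sum (oded k τ) ≢ 7 →
              (∃[ σ ] Shape m k τ σ) ⊎ (k ≡ 1 × τ ≡ replicate (2 + m) 0)
shape-total zero eq _ _ = inj₁ (_ , none eq)
shape-total (suc (suc i)) {_ ∷ []} eq _ _ with () ← trans eq (cong (2 +_) (+-suc i _))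
shape-total (suc (suc i)) {_ ∷ _ ∷ _} eq _ _ =
  inj₁ (_ , many i (sym (suc-injective (suc-injective eq))))
shape-total 1 {x ∷ y ∷ τ} eq (x≥y ∷ lk) ≢7 with m≤n⇒m<n∨m≡n x≥y
... | inj₁ y<x  = inj₁ (_ , strict y<x (suc-injective (suc-injective eq)))
... | inj₂ refl with plateau x τ lk | suc-injective (suc-injective eq)
... | inj₂ (j , r , ρ , refl , r<x) | refl = inj₁ (_ , flat j x r ρ r<x (sym
  (trans (length-++ (replicate j x))
    (trans (cong (_+ suc (length ρ)) (length-replicate j)) (+-suc j (length ρ))))))
shape-total 1 {zero ∷ _ ∷ τ} _ _ _ | inj₂ refl | inj₁ eq | refl = inj₂ (refl , cong (λ xs → 0 ∷ 0 ∷ xs) eq)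
shape-total 1 {suc t ∷ _ ∷ _ ∷ τ} _ _ _ | inj₂ refl | inj₁ eq | refl =
  inj₁ (subst (λ xs → ∃ (Shape (suc (length τ)) 1 (suc t ∷ suc t ∷ xs))) (sym eq)
    (_ , const (length τ) t refl))
shape-total 1 {1 ∷ _ ∷ []} _ _ ≢7 | inj₂ refl | inj₁ eq | refl = contradiction refl ≢7
shape-total 1 {suc (suc t) ∷ _ ∷ []} _ _ _ | inj₂ refl | inj₁ eq | refl = inj₁ (_ , const₁ t refl)

-- The injective relation between the two kinds of partitions.

-- The side conditions of zeros make 2 ∷ replicate p 1 a partition of at least
-- 4, and of at least 6 if c = 1.
data _⟶_ : List ℕ → List ℕ → Set where
  even  : ∀ {λs} → odds λs ≡ [] → OdEd λs → λs ⟶ λs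
  shape : ∀ {m k τ σ} → Desc τ → Shape m k τ σ → oded k τ ⟶ euod (suc m) σ
  zeros : ∀ m c p → c ≤ 1 → 2 * suc c ≤ p →
          (2 + m) * (2 + m) ≡ suc (sum (euod c (2 ∷ replicate p 1))) →
          oded 1 (replicate (2 + m) 0) ⟶ euod c (2 ∷ replicate p 1)

-- Compare lengths with `suc p`. For one odd part, `none` and `strict` give p ≤ 1; `const₁` gives p
-- = 3 with first part at least 2; `many i` gives p = i + 2 with first part above i. All contradict
-- `a + 2 ≤ p`.
shape≢ : ∀ {k τ σ} a p → Shape 0 k τ σ → a + 2 ≤ p → σ ≢ a ∷ replicate p 1
shape≢ a p s a+2≤p eq = length≢ s eq (trans (cong length eq) (cong suc (length-replicate p)))
  where
  2≤p = m+n≤o⇒n≤o a a+2≤p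
  length≢ : ∀ {k τ σ} → Shape 0 k τ σ → σ ≡ a ∷ replicate p 1 → length σ ≢ suc p
  length≢ (none |τ|≡1) _ |σ|≡ with () ← ≤-trans 2≤p (≤-reflexive (suc-injective (trans (sym |σ|≡) |τ|≡1)))
  length≢ (strict {τ = []} _ refl) _ refl with s≤s () ← 2≤p
  length≢ (const₁ t _) eq refl =
    <⇒≱ (+-monoˡ-≤ 2 (≤-trans (m≤m+n 2 t) (≤-reflexive (∷-injectiveˡ eq)))) a+2≤p
  length≢ (many i {x} {y} {τ} |τ|≡) eq refl =
    <⇒≱ (≤-trans (s≤s (≤-trans (i≤bonus 0 i) (m≤n+m (bonus 0 i) x))) (≤-reflexive (∷-injectiveˡ eq)))
        (+-cancelʳ-≤ 2 a i (≤-trans a+2≤p (≤-reflexive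
          (trans (cong suc (trans (length-map suc τ) (sym |τ|≡))) (sym (+-suc i 1))))))

odds-euod≢[] : ∀ l σ → suc l ≤ length σ → odds (euod (suc l) σ) ≢ []
odds-euod≢[] l (x ∷ σ) _ eq with () ← trans (sym (odds-odd (x + l) (euod l σ))) eq

even-repeated : ∀ x y σ → ¬ OdEd (map (2 *_) (x ∷ y ∷ y ∷ σ))
even-repeated x y σ (_ , u , _)
  rewrite evens-even x (map (2 *_) (y ∷ y ∷ σ)) | evens-even y (map (2 *_) (y ∷ σ))
        | evens-even y (map (2 *_) σ)
  with _ ∷ (y≢y ∷ _) ∷ _ ← u = y≢y refl

square-injective : ∀ m n → m * m ≡ n * n → m ≡ n
square-injective m n eq with <-cmp m n
... | tri< m<n _ _ = contradiction eq (<⇒≢ (*-mono-< m<n m<n))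
... | tri≈ _ m≡n _ = m≡n
... | tri> _ _ m>n = contradiction (sym eq) (<⇒≢ (*-mono-< m>n m>n))

-- For c = 0 the ones become repeated parts 2; for c = 1 there is an odd part.
even⇒≢ : ∀ {λs} c a p → c ≤ 1 → 2 ≤ p → odds λs ≡ [] → OdEd λs →
         λs ≢ euod c (a ∷ replicate p 1)
even⇒≢ zero       a (suc (suc p)) _ _ _ oe refl = even-repeated a 1 (replicate p 1) oe
even⇒≢ zero       a (suc zero) _ (s≤s ())
even⇒≢ (suc zero) a p _ _ od≡ _ refl = odds-euod≢[] 0 (a ∷ replicate p 1) (s≤s z≤n) od≡
even⇒≢ (suc (suc c)) _ _ (s≤s ())

-- `euod-injective` forces `suc m ≡ c`, so both sides have exactly one odd part and `shape≢`
-- applies.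
shape⇒≢ : ∀ {m k τ σ} c a p → c ≤ 1 → (1 ≤ c → a + 2 ≤ p) → Shape m k τ σ →
          euod (suc m) σ ≢ euod c (a ∷ replicate p 1)
shape⇒≢ {m} {σ = σ} c a p c≤1 a+2≤p s eq
  with euod-injective (suc m) c {σ} (shape-length-σ s) (≤-trans c≤1 (s≤s z≤n)) eq | c≤1
... | refl , σ≡ | s≤s z≤n = shape≢ a p s (a+2≤p (s≤s z≤n)) σ≡

-- The equation is a separate argument because the images are function applications, which do not
-- unify. Two shapes with equal images share `m` and σ, so `undo` recovers the same pair.
⟶-injective : ∀ {x x′ y y′} → x ⟶ y → x′ ⟶ y′ → y ≡ y′ → x ≡ x′
⟶-injective (even _ _) (even _ _) eq = eq
⟶-injective (even od≡ _) (shape {m} {σ = σ} _ s) refl =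
  contradiction od≡ (odds-euod≢[] m σ (shape-length-σ s))
⟶-injective (shape {m} {σ = σ} _ s) (even od≡ _) refl =
  contradiction od≡ (odds-euod≢[] m σ (shape-length-σ s))
⟶-injective (shape {m} {k} {σ = σ} lk s) (shape {m′} {σ = σ′} lk′ s′) eq
  with refl , refl ← euod-injective (suc m) (suc m′) {σ} {σ′} (shape-length-σ s) (shape-length-σ s′) eq =
  cong (λ (k , τ) → oded k τ) (trans (sym (undo-shape d d+l lk s)) (undo-shape d d+l lk′ s′))
  where
  d = length σ ∸ suc m
  d+l = m∸n+n≡m (shape-length-σ s)
-- Equal images have equal sums, and the sum plus 1 is the square of 2 + m.
⟶-injective (zeros m c p _ _ sq) (zeros m′ c′ p′ _ _ sq′) eq =
  cong (λ l → oded 1 (replicate l 0)) (square-injective (2 + m) (2 + m′)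
    (trans sq (trans (cong (suc ∘ sum) eq) (sym sq′))))
⟶-injective (even od≡ oe) (zeros _ c p c≤1 ≤p _) eq =
  contradiction eq (even⇒≢ c 2 p c≤1 (≤-trans (*-monoʳ-≤ 2 z<s) ≤p) od≡ oe)
⟶-injective (zeros _ c p c≤1 ≤p _) (even od≡ oe) eq =
  contradiction (sym eq) (even⇒≢ c 2 p c≤1 (≤-trans (*-monoʳ-≤ 2 z<s) ≤p) od≡ oe)
⟶-injective (shape _ s) (zeros _ c p c≤1 ≤p _) eq =
  contradiction eq (shape⇒≢ c 2 p c≤1 (λ 1≤c → ≤-trans (*-monoʳ-≤ 2 (s≤s 1≤c)) ≤p) s)
⟶-injective (zeros _ c p c≤1 ≤p _) (shape _ s) eq =
  contradiction (sym eq) (shape⇒≢ c 2 p c≤1 (λ 1≤c → ≤-trans (*-monoʳ-≤ 2 (s≤s 1≤c)) ≤p) s)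

⟶-misses : ∀ {x y} c p → c ≤ 1 → 3 ≤ p → x ⟶ y → y ≢ euod c (1 ∷ replicate p 1)
⟶-misses c p c≤1 3≤p (even od≡ oe) = even⇒≢ c 1 p c≤1 (≤-trans (n≤1+n 2) 3≤p) od≡ oe
⟶-misses c p c≤1 3≤p (shape _ s)  = shape⇒≢ c 1 p c≤1 (λ _ → 3≤p) s
-- Decoding both sides would equate the heads 2 and 1.
⟶-misses c p c≤1 3≤p (zeros _ c′ p′ c′≤1 _ _) eq
  with () ← proj₂ (euod-injective c′ c (≤-trans c′≤1 (s≤s z≤n)) (≤-trans c≤1 (s≤s z≤n)) eq)

-- Totality at a fixed size, and the strict inequality.

odds-oded : ∀ τ → odds (oded (length τ) τ) ≡ []
odds-oded []      = refl
odds-oded (x ∷ τ) = trans (odds-even (x + length τ) (oded (length τ) τ)) (odds-oded τ)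

euod-∈ : ∀ l {σ n} → l ≤ length σ → Desc σ → All (0 <_) (drop l σ) → sum (euod l σ) ≡ n →
         euod l σ ∈ filter euOd? (partitions n)
euod-∈ l l≤ lk pos Σ = ∈-filter⁺ euOd?
  (Equivalence.from ∈-partitions (euod-desc l l≤ lk , euod-positive l pos , Σ))
  (euod-EuOd l l≤ lk)

no-odds⇒EuOd : ∀ λs → odds λs ≡ [] → EuOd λs
no-odds⇒EuOd _ od≡ rewrite od≡ = [] , []

sum-hook : ∀ m → (2 + m) * (2 + m) ≡ suc (sum (oded 1 (replicate (2 + m) 0)))
sum-hook m = begin
  (2 + m) * (2 + m)                  ≡⟨ cong (λ l → l * l) (length-replicate (2 + m)) ⟨
  length τ * length τ                ≡⟨ cong (λ s → 2 * s + length τ * length τ) sum-τ ⟨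
  2 * sum τ + length τ * length τ    ≡⟨ sum-oded 1 τ (s≤s z≤n) ⟨
  sum (oded 1 τ) + 1                 ≡⟨ +-comm _ 1 ⟩
  suc (sum (oded 1 τ))               ∎
  where
  open ≡-Reasoning
  τ = replicate (2 + m) 0
  sum-τ : sum τ ≡ 0
  sum-τ = trans (sum-replicate (2 + m) 0) (*-zeroʳ (2 + m))

-- For c = 1 the square is 2h + 2, even and at least 10: neither 4 nor 9, so at least 16, whence h ≥
-- 7.
zeros-size : ∀ c h m → c ≤ 1 → 4 ≤ h → (2 + m) * (2 + m) ≡ suc (2 * h + c * c) → 2 * suc c ≤ h ∸ 2
zeros-size zero       h m             _        4≤h sq = ∸-monoˡ-≤ 2 4≤h
zeros-size (suc zero) h zero          _        4≤h sq = contradiction sq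
  (<⇒≢ (s≤s (≤-trans (≤-trans (m≤m+n 4 4) (*-monoʳ-≤ 2 4≤h)) (m≤m+n (2 * h) 1))))
zeros-size (suc zero) h (suc zero)    _        4≤h sq =
  contradiction (trans (suc-injective sq) (+-comm (2 * h) 1)) (even≢odd 4 h)
zeros-size (suc zero) h (suc (suc m)) _        4≤h sq = ∸-monoˡ-≤ 2 (≤-trans (n≤1+n 6) (s≤s⁻¹ 8≤1+h))
  where
  8≤1+h : 8 ≤ suc h
  8≤1+h = *-cancelˡ-≤ 2 (≤-trans (*-mono-≤ (m≤m+n 4 m) (m≤m+n 4 m)) (≤-reflexive
    (trans sq (trans (cong suc (+-comm (2 * h) 1)) (sym (*-suc 2 h))))))
zeros-size (suc (suc _)) _ _          (s≤s ())

module _ (c h : ℕ) (c≤1 : c ≤ 1) (4≤h : 4 ≤ h) where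

  -- `c` is the parity; `c * c` equals it and is the form in which `sum-euod` yields the size.
  n : ℕ
  n = 2 * h + c * c

  hook-sum : ∀ a p → a + p ≡ h → sum (euod c (a ∷ replicate p 1)) ≡ n
  hook-sum a p refl = trans (sum-euod c (a ∷ replicate p 1) (≤-trans c≤1 (s≤s z≤n)))
    (cong (λ s → 2 * (a + s) + c * c) (trans (sum-replicate p 1) (*-identityʳ p)))

  hook-∈ : ∀ a p → 1 ≤ a → a + p ≡ h → euod c (a ∷ replicate p 1) ∈ filter euOd? (partitions n)
  hook-∈ a p 1≤a eq = euod-∈ c (≤-trans c≤1 (s≤s z≤n))
    (∷-desc (All.replicate⁺ p 1≤a) (replicate-desc p))
    (All.drop⁺ c (1≤a ∷ All.replicate⁺ p z<s))
    (hook-sum a p eq)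

  ⟶-total : ∀ {x} → x ∈ filter odEd? (partitions n) →
            ∃[ y ] y ∈ filter euOd? (partitions n) × x ⟶ y
  ⟶-total x∈
    with x∈′ , oe ← ∈-filter⁻ odEd? {xs = partitions n} x∈
    with lk , pos , Σx ← Equivalence.to ∈-partitions x∈′
    with k , τ , k≤ , lkτ , refl ← oded-surjective lk oe
    with m≤n⇒m<n∨m≡n k≤
  -- All parts are even, so the partition is its own image.
  ... | inj₂ refl =
    _ , ∈-filter⁺ euOd? x∈′ (no-odds⇒EuOd (oded (length τ) τ) (odds-oded τ)) , even (odds-oded τ) oe
  ... | inj₁ k<
    with m , |τ|≡ ← m≤n⇒∃[o]m+o≡n k<
    with shape-total {m} k (trans (sym |τ|≡) (sym (+-suc k m))) lkτ
           (λ Σ≡7 → <⇒≱ (≤-trans (*-monoʳ-≤ 2 4≤h) (m≤m+n _ (c * c)))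
                         (≤-reflexive (trans (sym Σx) Σ≡7)))
  ... | inj₁ (σ , s) = _ , euod-∈ (suc m) (shape-length-σ s) (shape-desc s lkτ) (shape-positive s)
                             (trans (sum-euod-shape s) Σx) , shape lkτ s
  -- The remaining partition goes to the hook with first entry 2, and h - 2 ones complete the size.
  ... | inj₂ (refl , refl) = _ , hook-∈ 2 (h ∸ 2) (s≤s z≤n) 2+h∸2≡h ,
    zeros m c (h ∸ 2) c≤1 (zeros-size c h m c≤1 4≤h sq)
      (trans sq (cong suc (sym (hook-sum 2 (h ∸ 2) 2+h∸2≡h))))
    where
    2+h∸2≡h : 2 + (h ∸ 2) ≡ h
    2+h∸2≡h = m+[n∸m]≡n (≤-trans (s≤s (s≤s z≤n)) 4≤h)
    sq : (2 + m) * (2 + m) ≡ suc n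
    sq = trans (sum-hook m) (cong suc Σx)

  p-od-ed<p-eu-od : p-od-ed n < p-eu-od n
  p-od-ed<p-eu-od = injection⇒length< _⟶_ (λ r r′ → ⟶-injective r r′ refl)
    (Unique.filter⁺ odEd? (partitions-unique n)) ⟶-total
    -- The missed partition: σ consists of h ones.
    (hook-∈ 1 (h ∸ 1) ≤-refl (m+[n∸m]≡n (≤-trans z<s 4≤h)))
    (λ x r → ⟶-misses c (h ∸ 1) c≤1 (∸-monoˡ-≤ 1 4≤h) r refl)

theorem3p6 : (n : ℕ) → 8 ≤ n → p-od-ed n < p-eu-od n
theorem3p6 n 8≤n with half n
... | h , inj₁ refl = subst (λ n → p-od-ed n < p-eu-od n) (+-identityʳ (2 * h))
  (p-od-ed<p-eu-od 0 h z≤n (*-cancelˡ-≤ 2 8≤n))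
... | h , inj₂ refl = subst (λ n → p-od-ed n < p-eu-od n) (+-comm (2 * h) 1)
  -- 7 ≤ 2h reads 2 * 3 < 2 * h, hence 4 ≤ h.
  (p-od-ed<p-eu-od 1 h ≤-refl (*-cancelˡ-< 2 3 h (s≤s⁻¹ 8≤n)))
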